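{- Let $1\le l\le m\le n$ be integers, let $u=(u_1,\dots,u_l)\in[n]^l$ be strictly increasing with $u_i\ge n-m+i$ for all $1\le i\le l$, and let $\pi_{l+1},\dots,\pi_m\in[n]$. Let $$A_{\pi_{l+1},\dots,\pi_m}=\{v=(v_1,\dots,v_l)\in[n]^l:\ v_1<\cdots<v_l,\ (v_1,\dots,v_l,\pi_{l+1},\dots,\pi_m)\in \mathrm{PF}(m,n)\}$$ and let $[u]=\{v\in[n]^l:\ v_1<\cdots<v_l,\ v_i\le u_i \text{ for all } 1\le i\le l\}$. Then $A_{\pi_{l+1},\dots,\pi_m}=[u]$ if and only if $$(\pi_{l+1},\dots,\pi_m)\in \mathrm{MS}(m-n+u_1-1,\ u_1-1,\ u_2-u_1-1,\ \dots,\ u_l-u_{l-1}-1,\ n-u_l).$$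
   Context: Write $[n]=\{1,\dots,n\}$. For integers $0\le m\le n$, $\mathrm{PF}(m,n)$ denotes the set of parking functions with $m$ cars and $n$ spots: sequences $(\pi_1,\dots,\pi_m)\in[n]^m$ such that, when cars $1,\dots,m$ enter in order a one-way street with spots $1,\dots,n$ and car $i$ parks in spot $\pi_i$ if it is free and otherwise in the first free spot after $\pi_i$, all cars park. Equivalently, the non-decreasing rearrangement $(\lambda_1,\dots,\lambda_m)$ satisfies $\lambda_i\le n-m+i$ for all $i$. $\mathrm{PF}(0,n)$ consists of the empty sequence only. For $1\le l\le m\le n$ and strictly increasing $u=(u_1,\dots,u_l)\in[n]^l$ with $u_i\ge n-m+i$ for all $i$, the statement $(\pi_{l+1},\dots,\pi_m)\in \mathrm{MS}(m-n+u_1-1,u_1-1,u_2-u_1-1,\dots,u_l-u_{l-1}-1,n-u_l)$ ("parking function multi-shuffle") means: there exist parking functions $\alpha_1\in \mathrm{PF}(m-n+u_1-1,u_1-1)$, $\alpha_i\in \mathrm{PF}(u_i-u_{i-1}-1,u_i-u_{i-1}-1)$ for $2\le i\le l$, and $\alpha_{l+1}\in \mathrm{PF}(n-u_l,n-u_l)$ such that the sequence $(\pi_{l+1},\dots,\pi_m)$ is a permutation (as a multiset rearrangement) of the concatenation of the $l+1$ words $\alpha_1,\ \alpha_2+(u_1,\dots,u_1),\ \dots,\ \alpha_{l+1}+(u_l,\dots,u_l)$. -}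

module Defs where

open import Data.List.Base using (List; []; _∷_; _++_; length; map)
open import Data.List.Membership.Propositional using (_∈_; _∉_)
import Data.List.Relation.Unary.All as List using (All)
open import Data.List.Relation.Binary.Permutation.Propositional using (_↭_)
open import Data.Nat.Base using (ℕ; _+_; _∸_; _≤_; _<_)
open import Data.Product.Base using (_×_)
open import Data.Vec.Base using (Vec; []; _∷_; toList)
import Data.Vec.Relation.Unary.All as Vec using (All)
import Data.Vec.Relation.Unary.Linked as Vec using (Linked)
open import Data.Vec.Relation.Binary.Pointwise.Inductive using (Pointwise)
open import Level using (0ℓ)
open import Relation.Binary.PropositionalEquality.Core using (_≡_)
open import Relation.Unary using (Pred)

-- Spots and preferences are 1-based natural numbers.
InRange : ℕ → Pred ℕ 0ℓ
InRange n p = 1 ≤ p × p ≤ n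

-- s is the first spot of {p, …, n} not in the list occ of occupied spots.
record FirstFree (n : ℕ) (occ : List ℕ) (p s : ℕ) : Set where
  field
    p≤s      : p ≤ s
    s≤n      : s ≤ n
    free     : s ∉ occ
    occupied : ∀ t → p ≤ t → t < s → t ∈ occ

-- AllPark n occ π: starting with the spots in occ occupied, the cars with
-- preferences π, entering in this order, all park.
data AllPark (n : ℕ) (occ : List ℕ) : List ℕ → Set where
  []  : AllPark n occ []
  _∷_ : ∀ {p s π} → FirstFree n occ p s → AllPark n (s ∷ occ) π →
        AllPark n occ (p ∷ π)

-- Words are lists rather than vectors so that concatenations whose lengths
-- agree only propositionally can be treated as words of length m.
record PF (m n : ℕ) (π : List ℕ) : Set where
  field
    length≡m : length π ≡ m
    inRange  : List.All (InRange n) π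
    allPark  : AllPark n [] π

Increasing : ∀ {l} → ℕ → Pred (Vec ℕ l) 0ℓ
Increasing n v = Vec.All (InRange n) v × Vec.Linked _<_ v

-- A m n (π_{l+1}, …, π_m), where l is the length of v.
A : ∀ {l} → ℕ → ℕ → List ℕ → Pred (Vec ℕ l) 0ℓ
A m n π v = Increasing n v × PF m n (toList v ++ π)

-- The set [u].
Below : ∀ {l} → ℕ → Vec ℕ l → Pred (Vec ℕ l) 0ℓ
Below n u v = Increasing n v × Pointwise _≤_ v u

-- For us = (u_{i+1}, …, u_l), Blocks n u_i us w says that w is a concatenation
-- (α_{i+1} + u_i) ++ … ++ (α_{l+1} + u_l) with α_j ∈ PF(u_j - u_{j-1} - 1,
-- u_j - u_{j-1} - 1) for i < j ≤ l and α_{l+1} ∈ PF(n - u_l, n - u_l).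
data Blocks (n : ℕ) (c : ℕ) : ∀ {k} → Vec ℕ k → List ℕ → Set where
  last : ∀ {α} → PF (n ∸ c) (n ∸ c) α → Blocks n c [] (map (_+ c) α)
  next : ∀ {k u} {us : Vec ℕ k} {α w} →
         PF (u ∸ c ∸ 1) (u ∸ c ∸ 1) α → Blocks n u us w →
         Blocks n c (u ∷ us) (map (_+ c) α ++ w)

-- MS m n u π: π ∈ MS(m-n+u₁-1, u₁-1, u₂-u₁-1, …, u_l-u_{l-1}-1, n-u_l).
-- Only meaningful for m ≤ n and increasing u ∈ [n]^l with u_i ≥ n-m+i, in
-- which case no truncated subtraction below underflows; m - n + u₁ - 1 is
-- written with the addition first for this reason.
data MS (m n : ℕ) : ∀ {l} → Vec ℕ l → List ℕ → Set where
  shuffle : ∀ {k u₁} {us : Vec ℕ k} {α₁ w π} →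
            PF (m + u₁ ∸ n ∸ 1) (u₁ ∸ 1) α₁ → Blocks n u₁ us w →
            π ↭ α₁ ++ w →
            MS m n (u₁ ∷ us) π

{-# OPTIONS --safe #-}

-- Write above k π for the number of entries of π exceeding k. A word π with
-- positive entries is a parking function with n spots iff above k π + k ≤ n
-- for all k ≤ n; call the word tight at k if equality holds. Being in
-- MS(m-n+u₁-1, …) means exactly that u ++ π fits in this sense and is tight at
-- every u_i, since tightness at u_i cuts the count into independent conditions
-- on the gaps between consecutive u_i.
-- Decreasing entries preserves fitting, so [u] ⊆ A iff u ∈ A. If u ++ π is tight
-- at u_i, then no v ∈ A has more entries above u_i than u, which forces v ≤ u.
-- If it is not tight at u_i, then neither is it at u_i + 1 when u_i + 1 = u_{i+1},
-- and otherwise replacing u_i by u_i + 1 gives an element of A outside [u].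
module Submission where

open import Defs
open import Data.Fin.Base using (toℕ)
open import Data.List.Base using (List; []; _∷_; _++_; length; map)
open import Data.List.Membership.DecPropositional using (_∈?_)
open import Data.List.Membership.Propositional using (_∈_)
open import Data.List.Membership.Propositional.Properties using (∈-++⁺ʳ)
open import Data.List.Properties using (++-identityʳ; length-++; length-map; map-++; map-id; map-∘; map-cong)
open import Data.List.Relation.Binary.Permutation.Propositional using (_↭_; ↭-refl; ↭-reflexive; ↭-sym; ↭-trans; prep)
open import Data.List.Relation.Binary.Permutation.Propositional.Properties using (map⁺; shift; shifts; ++⁺ˡ; All-resp-↭; ↭-length)
open import Data.List.Relation.Unary.All as ListAll using ([]; _∷_)
import Data.List.Relation.Unary.All.Properties as ListAll
open import Data.List.Relation.Unary.AllPairs using ([]; _∷_)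
open import Data.List.Relation.Unary.Any using (here; there)
open import Data.List.Relation.Unary.Unique.Propositional using (Unique)
open import Data.Nat.Base using (ℕ; zero; suc; _+_; _∸_; _≤_; _<_; z≤n; s≤s)
open import Data.Nat.ListAction using (sum)
open import Data.Nat.ListAction.Properties using (sum-++; sum-↭)
open import Data.Nat.Properties
open import Data.Nat.Tactic.RingSolver using (solve-∀)
open import Data.Product.Base using (∃; ∃₂; _×_; _,_; proj₁; proj₂)
open import Data.Sum.Base using (_⊎_; inj₁; inj₂; [_,_]′)
open import Data.Vec.Base using (Vec; []; _∷_; lookup; toList)
open import Data.Vec.Properties using (length-toList)
open import Data.Vec.Relation.Binary.Pointwise.Inductive as Pointwise using (Pointwise; []; _∷_)
open import Data.Vec.Relation.Unary.All as VecAll using (All; []; _∷_)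
import Data.Vec.Relation.Unary.All.Properties as VecAll
open import Data.Vec.Relation.Unary.Linked as Linked using (Linked; []; [-]; _∷_)
open import Function.Base using (_∘_)
open import Function.Bundles using (_⇔_; mk⇔)
open import Relation.Binary.PropositionalEquality
open import Relation.Nullary using (yes; no; contradiction)
open import Relation.Unary using (_≐_)

-- Counting the entries above a threshold

-- The indicator of `k < x`, valued in `ℕ` so that counts are sums and entrywise inequalities add
-- up.
gt : ℕ → ℕ → ℕ
gt k       zero    = 0
gt zero    (suc x) = 1
gt (suc k) (suc x) = gt k x

gt-< : ∀ {k x} → k < x → gt k x ≡ 1
gt-< {zero}  {suc x} _         = refl
gt-< {suc k} {suc x} (s≤s k<x) = gt-< k<x

gt-≥ : ∀ {k x} → x ≤ k → gt k x ≡ 0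
gt-≥ {k}     {zero}  _         = refl
gt-≥ {suc k} {suc x} (s≤s x≤k) = gt-≥ x≤k

gt-monoʳ : ∀ k {x y} → x ≤ y → gt k x ≤ gt k y
gt-monoʳ k       z≤n       = z≤n
gt-monoʳ zero    (s≤s _)   = ≤-refl
gt-monoʳ (suc k) (s≤s x≤y) = gt-monoʳ k x≤y

gt-suc-≤ : ∀ k x → gt (suc k) x ≤ gt k x
gt-suc-≤ k       zero          = z≤n
gt-suc-≤ zero    (suc zero)    = z≤n
gt-suc-≤ zero    (suc (suc x)) = ≤-refl
gt-suc-≤ (suc k) (suc x)       = gt-suc-≤ k x

gt-suc-≢ : ∀ {k x} → suc k ≢ x → gt (suc k) x ≡ gt k x
gt-suc-≢ {k}     {zero}        _ = refl
gt-suc-≢ {zero}  {suc zero}    p = contradiction refl p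
gt-suc-≢ {zero}  {suc (suc x)} _ = refl
gt-suc-≢ {suc k} {suc x}       p = gt-suc-≢ (p ∘ cong suc)

gt-≢-suc : ∀ {k x} → k ≢ x → gt k (suc x) ≡ gt k x
gt-≢-suc {zero}  {zero}  p = contradiction refl p
gt-≢-suc {zero}  {suc x} p = refl
gt-≢-suc {suc k} {zero}  p = refl
gt-≢-suc {suc k} {suc x} p = gt-≢-suc (p ∘ cong suc)

gt-+ : ∀ c k x → gt (k + c) (x + c) ≡ gt k x
gt-+ zero    k x rewrite +-identityʳ k | +-identityʳ x = refl
gt-+ (suc c) k x rewrite +-suc k c | +-suc x c = gt-+ c k x

above : ℕ → List ℕ → ℕ
above k xs = sum (map (gt k) xs)

above-++ : ∀ k xs ys → above k (xs ++ ys) ≡ above k xs + above k ys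
above-++ k xs ys = trans (cong sum (map-++ (gt k) xs ys)) (sum-++ (map (gt k) xs) _)

above-↭ : ∀ k {xs ys} → xs ↭ ys → above k xs ≡ above k ys
above-↭ k xs↭ys = sum-↭ (map⁺ (gt k) xs↭ys)

above-< : ∀ {k xs} → ListAll.All (k <_) xs → above k xs ≡ length xs
above-< []           = refl
above-< (k<x ∷ k<xs) = cong₂ _+_ (gt-< k<x) (above-< k<xs)

above-≥ : ∀ {k xs} → ListAll.All (_≤ k) xs → above k xs ≡ 0
above-≥ []           = refl
above-≥ (x≤k ∷ xs≤k) = cong₂ _+_ (gt-≥ x≤k) (above-≥ xs≤k)

above-≥⁻ : ∀ {k} xs → above k xs ≤ 0 → ListAll.All (_≤ k) xs
above-≥⁻     []       _ = []
above-≥⁻ {k} (x ∷ xs) p =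
  ≮⇒≥ (λ k<x → contradiction (≤-trans (≤-reflexive (sym (gt-< k<x))) (m+n≤o⇒m≤o (gt k x) p)) λ ())
  ∷ above-≥⁻ xs (m+n≤o⇒n≤o (gt k x) p)

above-map-+ : ∀ c k xs → above (k + c) (map (_+ c) xs) ≡ above k xs
above-map-+ c k xs = cong sum (trans (sym (map-∘ xs)) (map-cong (gt-+ c k) xs))

above-suc-≤ : ∀ k xs → above (suc k) xs ≤ above k xs
above-suc-≤ k []       = z≤n
above-suc-≤ k (x ∷ xs) = +-mono-≤ (gt-suc-≤ k x) (above-suc-≤ k xs)

above-suc-∈ : ∀ {k xs} → suc k ∈ xs → suc (above (suc k) xs) ≤ above k xs
above-suc-∈ {k} {_ ∷ xs} (here refl)
  rewrite gt-≥ (≤-refl {suc k}) | gt-< (n<1+n k) = s≤s (above-suc-≤ k xs)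
above-suc-∈ {k} {x ∷ xs} (there k∈xs) =
  ≤-trans (≤-reflexive (sym (+-suc (gt (suc k) x) _))) (+-mono-≤ (gt-suc-≤ k x) (above-suc-∈ k∈xs))

above-suc-∉ : ∀ {k xs} → ListAll.All (suc k ≢_) xs → above (suc k) xs ≡ above k xs
above-suc-∉ []       = refl
above-suc-∉ (p ∷ ps) = cong₂ _+_ (gt-suc-≢ p) (above-suc-∉ ps)

-- Only entries equal to `suc k` are lost, and there is at most one of them.
above-suc-unique : ∀ k {xs} → Unique xs → above k xs ≤ suc (above (suc k) xs)
above-suc-unique k [] = z≤n
above-suc-unique k {x ∷ xs} (x∉xs ∷ xs!) with suc k ≟ x
... | yes refl rewrite gt-≥ (≤-refl {suc k}) | gt-< (n<1+n k) | above-suc-∉ x∉xs = ≤-refl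
... | no k+1≢x rewrite gt-suc-≢ k+1≢x =
  ≤-trans (+-monoʳ-≤ (gt k x) (above-suc-unique k xs!)) (≤-reflexive (+-suc (gt k x) _))

-- Each raise of the threshold past a spot in `xs` loses at least one entry, and there are `d` such
-- raises.
above-interval : ∀ {xs} a d → (∀ t → a < t → t ≤ d + a → t ∈ xs) → above (d + a) xs + d ≤ above a xs
above-interval      a zero    _ = ≤-reflexive (+-identityʳ _)
above-interval {xs} a (suc d) p = begin
  above (suc d + a) xs + suc d   ≡⟨ +-suc _ d ⟩
  suc (above (suc d + a) xs) + d ≤⟨ +-monoˡ-≤ d (above-suc-∈ (p (suc d + a) (s≤s (m≤n+m a d)) ≤-refl)) ⟩
  above (d + a) xs + d           ≤⟨ above-interval a d (λ t a<t t≤d+a → p t a<t (m≤n⇒m≤1+n t≤d+a)) ⟩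
  above a xs                     ∎
  where open ≤-Reasoning

above-mono : ∀ k {l} {v u : Vec ℕ l} → Pointwise _≤_ v u → above k (toList v) ≤ above k (toList u)
above-mono k []          = z≤n
above-mono k (x≤y ∷ v≤u) = +-mono-≤ (gt-monoʳ k x≤y) (above-mono k v≤u)

-- The counting criterion

-- The thresholds start at `c` so that the criterion also applies to the part of a word beyond a
-- cut, without shifting its entries.
FitsFrom : ℕ → ℕ → List ℕ → Set
FitsFrom n c xs = ∀ k → c ≤ k → k ≤ n → above k xs + k ≤ n

fits-≤ : ∀ {n c xs ys} → (∀ k → above k xs ≤ above k ys) → FitsFrom n c ys → FitsFrom n c xs
fits-≤ p fits k c≤k k≤n = ≤-trans (+-monoˡ-≤ k (p k)) (fits k c≤k k≤n)

fits-↭ : ∀ {n c xs ys} → ys ↭ xs → FitsFrom n c ys → FitsFrom n c xs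
fits-↭ {xs = xs} {ys} ys↭xs =
  fits-≤ {xs = xs} {ys} (λ k → ≤-reflexive (sym (above-↭ k ys↭xs)))

-- The threshold `k = n` leaves no room for an entry above it.
fits⇒≤ : ∀ {n c} xs → c ≤ n → FitsFrom n c xs → ListAll.All (_≤ n) xs
fits⇒≤ {n} xs c≤n fits = above-≥⁻ xs (+-cancelʳ-≤ n _ 0 (fits n c≤n ≤-refl))

fits-map-+⁺ : ∀ {d} c xs → FitsFrom d 0 xs → FitsFrom (d + c) c (map (_+ c) xs)
fits-map-+⁺ {d} c xs fits k c≤k k≤d+c with k ∸ c | m∸n+n≡m c≤k
... | j | refl rewrite above-map-+ c j xs | sym (+-assoc (above j xs) j c) =
  +-monoˡ-≤ c (fits j z≤n (+-cancelʳ-≤ c j d k≤d+c))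

fits-map-+⁻ : ∀ {d} c xs → FitsFrom (d + c) c (map (_+ c) xs) → FitsFrom d 0 xs
fits-map-+⁻ {d} c xs fits j _ j≤d = +-cancelʳ-≤ c _ d (begin
  above j xs + j + c                     ≡⟨ +-assoc _ j c ⟩
  above j xs + (j + c)                   ≡⟨ cong (_+ (j + c)) (above-map-+ c j xs) ⟨
  above (j + c) (map (_+ c) xs) + (j + c) ≤⟨ fits (j + c) (m≤n+m c j) (+-monoˡ-≤ c j≤d) ⟩
  d + c                                  ∎)
  where open ≤-Reasoning

-- Parking

-- At most `n ∸ k` distinct entries lie strictly above `k` and up to `n`; `go` lifts the threshold
-- to `n`, losing at most one entry each time.
unique⇒fits : ∀ {n xs} → Unique xs → ListAll.All (_≤ n) xs → FitsFrom n 0 xs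
unique⇒fits {n} {xs} xs! xs≤n k _ k≤n with n ∸ k | m∸n+n≡m k≤n
... | d | refl = +-monoˡ-≤ k (go d k xs≤n)
  where
  go : ∀ d k → ListAll.All (_≤ d + k) xs → above k xs ≤ d
  go zero    k p = ≤-reflexive (above-≥ p)
  go (suc d) k p = ≤-trans (above-suc-unique k xs!)
    (s≤s (go d (suc k) (subst (λ t → ListAll.All (_≤ t) xs) (sym (+-suc d k)) p)))

-- The spots occupied in the end are distinct and at most `n`, so they fit. Going back from the last
-- car to the first, each spot is replaced by the preference, which is no larger, so the word still
-- fits.
allPark⇒fits : ∀ {n occ π} → Unique occ → ListAll.All (_≤ n) occ → AllPark n occ π → FitsFrom n 0 (π ++ occ)
allPark⇒fits occ! occ≤n [] = unique⇒fits occ! occ≤n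
allPark⇒fits {n} {occ} {p ∷ π} occ! occ≤n (_∷_ {s = s} ff park) =
  fits-≤ {xs = p ∷ π ++ occ} {ys = s ∷ π ++ occ} (λ k → +-monoˡ-≤ _ (gt-monoʳ k p≤s))
    (fits-↭ (shift s π occ)
      (allPark⇒fits (ListAll.¬Any⇒All¬ occ free ∷ occ!) (s≤n ∷ occ≤n) park))
  where open FirstFree ff

-- The equation makes `d` the number of spots from `p` to `n`, so the search is structural in `d`.
searchFree : ∀ {n} occ d p → d + p ≡ suc n →
             ∃ (FirstFree n occ p) ⊎ (∀ t → p ≤ t → t ≤ n → t ∈ occ)
searchFree occ zero    p refl = inj₂ λ t p≤t t≤n → contradiction p≤t (<⇒≱ (s≤s t≤n))
searchFree {n} occ (suc d) p eq with _∈?_ _≟_ p occ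
... | no p∉occ = inj₁ (p , record
  { p≤s = ≤-refl
  ; s≤n = subst (p ≤_) (suc-injective eq) (m≤n+m p d)
  ; free = p∉occ
  ; occupied = λ t p≤t t<p → contradiction p≤t (<⇒≱ t<p)
  })
... | yes p∈occ with searchFree occ d (suc p) (trans (+-suc d p) eq)
...   | inj₁ (s , ff) = inj₁ (s , record
  { p≤s = ≤-trans (n≤1+n p) p≤s
  ; s≤n = s≤n
  ; free = free
  ; occupied = λ t p≤t t<s →
      [ (λ p<t → occupied t p<t t<s) , (λ { refl → p∈occ }) ]′ (m≤n⇒m<n∨m≡n p≤t)
  })
  where open FirstFree ff
...   | inj₂ full = inj₂ λ t p≤t t≤n →
  [ (λ p<t → full t p<t t≤n) , (λ { refl → p∈occ }) ]′ (m≤n⇒m<n∨m≡n p≤t)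

-- The spots suc a, …, k that are taken contribute k - a to above a, so the car
-- preferring suc a leaves room for one more car above k.
fits-interval : ∀ {n a xs k} → FitsFrom n 0 (suc a ∷ xs) → a ≤ n → a ≤ k →
                (∀ t → a < t → t ≤ k → t ∈ xs) → suc (above k xs + k) ≤ n
fits-interval {n} {a} {xs} {k} fits a≤n a≤k p with k ∸ a | m∸n+n≡m a≤k
... | d | refl = begin
  suc (above (d + a) xs + (d + a)) ≡⟨ cong suc (+-assoc _ d a) ⟨
  suc (above (d + a) xs + d + a)   ≤⟨ s≤s (+-monoˡ-≤ a (above-interval a d p)) ⟩
  suc (above a xs + a)             ≡⟨ cong (λ z → z + above a xs + a) (gt-< (n<1+n a)) ⟨
  above a (suc a ∷ xs) + a         ≤⟨ fits a z≤n a≤n ⟩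
  n                                ∎
  where open ≤-Reasoning

-- Only the counts for `p ≤ k < s` grow, by one, and there the taken spots `p, …, k` provide the
-- room.
fits-displace : ∀ {n p s xs} → 1 ≤ p → p ≤ n → p ≤ s → (∀ t → p ≤ t → t < s → t ∈ xs) →
                FitsFrom n 0 (p ∷ xs) → FitsFrom n 0 (s ∷ xs)
fits-displace {p = suc a} {s} {xs} _ p≤n p≤s occ fits k _ k≤n with s ≤? k | suc a ≤? k
... | yes s≤k | _ = ≤-trans
  (≤-reflexive (cong (λ z → z + above k xs + k) (trans (gt-≥ s≤k) (sym (gt-≥ (≤-trans p≤s s≤k))))))
  (fits k z≤n k≤n)
... | no s≰k  | no p≰k = ≤-trans
  (≤-reflexive (cong (λ z → z + above k xs + k) (trans (gt-< (≰⇒> s≰k)) (sym (gt-< (≰⇒> p≰k))))))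
  (fits k z≤n k≤n)
... | no s≰k  | yes p≤k rewrite gt-< (≰⇒> s≰k) =
  fits-interval fits (<⇒≤ p≤n) (<⇒≤ p≤k) (λ t a<t t≤k → occ t a<t (≤-<-trans t≤k (≰⇒> s≰k)))

-- The invariant is that the remaining preferences together with the occupied spots fit; parking a
-- car preserves it by `fits-displace`.
fits⇒allPark : ∀ {n} occ {π} → ListAll.All (InRange n) π → FitsFrom n 0 (π ++ occ) → AllPark n occ π
fits⇒allPark occ [] fits = []
fits⇒allPark {n} occ {suc a ∷ π} ((1≤p , p≤n) ∷ r) fits
  with searchFree occ (n ∸ a) (suc a) (trans (+-suc _ a) (cong suc (m∸n+n≡m (<⇒≤ p≤n))))
... | inj₁ (s , ff) = ff ∷ fits⇒allPark (s ∷ occ) r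
  (fits-↭ (↭-sym (shift s π occ))
    (fits-displace 1≤p p≤n p≤s (λ t p≤t t<s → ∈-++⁺ʳ π (occupied t p≤t t<s)) fits))
  where open FirstFree ff
-- If all of `suc a, …, n` were taken, `fits-interval` at `k = n` would bound a number exceeding `n`
-- by `n`.
... | inj₂ full = contradiction
  (fits-interval fits (<⇒≤ p≤n) (<⇒≤ p≤n) (λ t p≤t t≤n → ∈-++⁺ʳ π (full t p≤t t≤n)))
  (≤⇒≯ (m≤n+m n _))

PF⇒fits : ∀ {m n π} → PF m n π → FitsFrom n 0 π
PF⇒fits {n = n} {π} pf = fits-↭ (↭-reflexive (++-identityʳ π)) (allPark⇒fits [] [] (PF.allPark pf))

fits⇒PF : ∀ {n π} → ListAll.All (1 ≤_) π → FitsFrom n 0 π → PF (length π) n π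
fits⇒PF {n} {π} 1≤π fits = record
  { length≡m = refl
  ; inRange  = inRange
  ; allPark  = fits⇒allPark [] inRange (fits-↭ (↭-reflexive (sym (++-identityʳ π))) fits)
  }
  where
  inRange = ListAll.zip (1≤π , fits⇒≤ π z≤n fits)

-- Cutting a word at a tight spot

TightAt : ℕ → List ℕ → ℕ → Set
TightAt n xs t = above t xs + t ≡ n

tight-↭ : ∀ {n t xs ys} → xs ↭ ys → TightAt n xs t → TightAt n ys t
tight-↭ {t = t} xs↭ys tight = trans (cong (_+ t) (sym (above-↭ t xs↭ys))) tight

above-cut-≥ : ∀ {k u lo} hi → ListAll.All (_≤ u) lo → u ≤ k → above k (lo ++ u ∷ hi) ≡ above k hi
above-cut-≥ {k} {u} {lo} hi lo≤u u≤k = trans (above-++ k lo (u ∷ hi))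
  (cong₂ _+_ (above-≥ (ListAll.map (λ x≤u → ≤-trans x≤u u≤k) lo≤u)) (cong (_+ above k hi) (gt-≥ u≤k)))

above-cut-< : ∀ {k u} lo {hi} → ListAll.All (u <_) hi → k < u →
              above k (lo ++ u ∷ hi) ≡ above k lo + suc (length hi)
above-cut-< {k} {u} lo {hi} u<hi k<u = trans (above-++ k lo (u ∷ hi))
  (cong (above k lo +_) (above-< (k<u ∷ ListAll.map (<-trans k<u) u<hi)))

-- For `k ≤ p` the cut point and all of `hi` exceed `k` and contribute `suc (length hi)`, which is
-- `n ∸ p`; this leaves the condition on `lo` with `p` spots. For larger `k` only `hi` counts.
fits-join : ∀ {n c p lo hi} → ListAll.All (_≤ p) lo → ListAll.All (suc p <_) hi →
            length hi + suc p ≡ n → FitsFrom p c lo → FitsFrom n (suc p) hi →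
            FitsFrom n c (lo ++ suc p ∷ hi)
fits-join {n} {c} {p} {lo} {hi} lo≤p p<hi refl fitsˡ fitsʰ k c≤k k≤n with suc p ≤? k
... | yes p<k = ≤-trans
  (≤-reflexive (cong (_+ k) (above-cut-≥ hi (ListAll.map m≤n⇒m≤1+n lo≤p) p<k))) (fitsʰ k p<k k≤n)
... | no p≮k = begin
  above k (lo ++ suc p ∷ hi) + k      ≡⟨ cong (_+ k) (above-cut-< lo p<hi (≰⇒> p≮k)) ⟩
  above k lo + suc (length hi) + k    ≡⟨ rearrange (above k lo) (length hi) k ⟩
  above k lo + k + suc (length hi)    ≤⟨ +-monoˡ-≤ _ (fitsˡ k c≤k (≮⇒≥ p≮k)) ⟩
  p + suc (length hi)                 ≡⟨ swap-suc p (length hi) ⟩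
  length hi + suc p                   ∎
  where
  open ≤-Reasoning
  rearrange : ∀ a b c → a + suc b + c ≡ a + c + suc b
  rearrange = solve-∀
  swap-suc : ∀ a b → a + suc b ≡ b + suc a
  swap-suc = solve-∀

fits-cutˡ : ∀ {n c p lo hi} → ListAll.All (suc p <_) hi → length hi + suc p ≡ n →
            FitsFrom n c (lo ++ suc p ∷ hi) → FitsFrom p c lo
fits-cutˡ {n} {c} {p} {lo} {hi} p<hi refl fits k c≤k k≤p = +-cancelˡ-≤ (suc (length hi)) _ _ (begin
  suc (length hi) + (above k lo + k)  ≡⟨ rearrange (length hi) (above k lo) k ⟩
  above k lo + suc (length hi) + k    ≡⟨ cong (_+ k) (above-cut-< lo p<hi (s≤s k≤p)) ⟨
  above k (lo ++ suc p ∷ hi) + k      ≤⟨ fits k c≤k (≤-trans k≤p (≤-trans (n≤1+n p) (m≤n+m _ (length hi)))) ⟩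
  length hi + suc p                   ≡⟨ +-suc (length hi) p ⟩
  suc (length hi) + p                 ∎)
  where
  open ≤-Reasoning
  rearrange : ∀ a b c → suc a + (b + c) ≡ b + suc a + c
  rearrange = solve-∀

fits-cutʳ : ∀ {n c u lo} hi → ListAll.All (_≤ u) lo → c ≤ u →
            FitsFrom n c (lo ++ u ∷ hi) → FitsFrom n u hi
fits-cutʳ hi lo≤u c≤u fits k u≤k k≤n = ≤-trans
  (≤-reflexive (cong (_+ k) (sym (above-cut-≥ hi lo≤u u≤k)))) (fits k (≤-trans c≤u u≤k) k≤n)

separate : ∀ u xs → ∃₂ λ lo hi → xs ↭ lo ++ hi × ListAll.All (_≤ u) lo × ListAll.All (u <_) hi
separate u [] = [] , [] , ↭-refl , [] , []
separate u (x ∷ xs) with x ≤? u | separate u xs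
... | yes x≤u | lo , hi , p , lo≤u , u<hi = x ∷ lo , hi , prep x p , x≤u ∷ lo≤u , u<hi
... | no x≰u  | lo , hi , p , lo≤u , u<hi =
  lo , x ∷ hi , ↭-trans (prep x p) (↭-sym (shift x lo hi)) , lo≤u , ≰⇒> x≰u ∷ u<hi

map-∸-+ : ∀ {c xs} → ListAll.All (c <_) xs → map (_+ c) (map (_∸ c) xs) ≡ xs
map-∸-+ []           = refl
map-∸-+ (c<x ∷ c<xs) = cong₂ _∷_ (m∸n+n≡m (<⇒≤ c<x)) (map-∸-+ c<xs)

map-∸-positive : ∀ {c xs} → ListAll.All (c <_) xs → ListAll.All (1 ≤_) (map (_∸ c) xs)
map-∸-positive = ListAll.map⁺ ∘ ListAll.map m<n⇒0<n∸m

map-+-> : ∀ c {m n α} → PF m n α → ListAll.All (c <_) (map (_+ c) α)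
map-+-> c pf = ListAll.map⁺ (ListAll.map (λ (1≤x , _) → +-monoˡ-≤ c 1≤x) (PF.inRange pf))

-- `d` is the number of spots strictly between `c` and `u`. Matching on the equations removes
-- truncated subtraction from the block size.
<⇒gap : ∀ {c u} → c < u → ∃ λ d → u ≡ suc (d + c) × u ∸ c ∸ 1 ≡ d
<⇒gap {c} {u} c<u =
  u ∸ suc c , trans (sym (m∸n+n≡m c<u)) (+-suc _ c) ,
  trans (∸-+-assoc u c 1) (cong (u ∸_) (+-comm c 1))

linked⇒all : ∀ {c k} {us : Vec ℕ k} → Linked _<_ (c ∷ us) → All (c <_) us
linked⇒all              [-]        = []
linked⇒all {us = _ ∷ _} (c<u ∷ l) = c<u ∷ VecAll.map (<-trans c<u) (linked⇒all l)

-- Up to rearrangement of w, this characterises Blocks n c us w.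
record Gaps (n c : ℕ) {k} (us : Vec ℕ k) (w : List ℕ) : Set where
  field
    larger : ListAll.All (c <_) w
    fits   : FitsFrom n c (toList us ++ w)
    tight  : All (TightAt n (toList us ++ w)) us
    full   : length (toList us ++ w) + c ≡ n

cut-↭ : ∀ u us lo {hi w : List ℕ} → w ↭ lo ++ hi → u ∷ us ++ w ↭ lo ++ u ∷ us ++ hi
cut-↭ u us lo {hi} w↭ =
  ↭-trans (prep u (↭-trans (++⁺ˡ us w↭) (shifts us lo))) (↭-sym (shift u lo (us ++ hi)))

-- The number of cars `a` is left free because the first block, the one with `c = 0`, may have fewer
-- cars than spots. Thresholds from `u` on see only the part `H` beyond `u`, so tightness there
-- carries over; at `u` itself it is the fullness of `H`.
gaps-join : ∀ {n c u a k} {us : Vec ℕ k} {α w} → c < u → All (u <_) us →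
            PF a (u ∸ c ∸ 1) α → Gaps n u us w →
            FitsFrom n c (u ∷ toList us ++ map (_+ c) α ++ w) ×
            All (TightAt n (u ∷ toList us ++ map (_+ c) α ++ w)) (u ∷ us)
gaps-join {n} {c} {us = us} {α} {w} c<u u<us pf gaps with <⇒gap c<u
... | d , refl , eq rewrite eq =
  fits-↭ (↭-sym perm) (fits-join lo≤p u<H full fitsLo fits) ,
  tightCut full′ ≤-refl ∷
  VecAll.map (λ (t , u<t) → tightCut t (<⇒≤ u<t)) (VecAll.zip (tight , u<us))
  where
  open Gaps gaps
  lo = map (_+ c) α
  H = toList us ++ w
  perm = cut-↭ (suc (d + c)) (toList us) lo {w} ↭-refl
  fitsLo = fits-map-+⁺ c α (PF⇒fits pf)
  lo≤p = fits⇒≤ lo (m≤n+m c d) fitsLo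
  u<H = ListAll.++⁺ (VecAll.toList⁺ u<us) larger
  full′ = trans (cong (_+ suc (d + c)) (above-< u<H)) full
  tightCut : ∀ {t} → TightAt n H t → suc (d + c) ≤ t → TightAt n (suc (d + c) ∷ toList us ++ lo ++ w) t
  tightCut {t} tt u≤t = tight-↭ (↭-sym perm)
    (trans (cong (_+ t) (above-cut-≥ H (ListAll.map m≤n⇒m≤1+n lo≤p) u≤t)) tt)

-- Tightness at `u` says that exactly `n ∸ u` entries exceed `u`. This is the fullness that turns
-- the condition below `u` into one on the gap alone.
gaps-split : ∀ {n c u k} {us : Vec ℕ k} {w} → c < u → All (u <_) us → ListAll.All (c <_) w →
             FitsFrom n c (u ∷ toList us ++ w) → All (TightAt n (u ∷ toList us ++ w)) (u ∷ us) →
             ∃₂ λ α w′ → w ↭ map (_+ c) α ++ w′ × PF (length α) (u ∸ c ∸ 1) α × Gaps n u us w′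
gaps-split {n} {c} {us = us} {w} c<u u<us c<w fits (tight₁ ∷ tight) with <⇒gap c<u
... | d , refl , eq rewrite eq with separate (suc (d + c)) w
... | lo , hi , w↭ , lo≤u , u<hi =
  map (_∸ c) lo , hi , ↭-trans w↭ (↭-reflexive (cong (_++ hi) (sym (map-∸-+ c<lo)))) ,
  -- By construction `lo` could still contain `u` itself; the fit obtained from `fits-cutˡ` rules
  -- this out.
  fits⇒PF (map-∸-positive c<lo)
    (fits-map-+⁻ c (map (_∸ c) lo) (subst (FitsFrom (d + c) c) (sym (map-∸-+ c<lo))
      (fits-cutˡ {lo = lo} u<H full fits′))) ,
  record
    { larger = u<hi
    ; fits = fits-cutʳ H lo≤u (<⇒≤ c<u) fits′
    ; tight = VecAll.map (λ (t , u<t) → tightCut t (<⇒≤ u<t)) (VecAll.zip (tight , u<us))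
    ; full = full
    }
  where
  H = toList us ++ hi
  perm = cut-↭ (suc (d + c)) (toList us) lo w↭
  fits′ = fits-↭ perm fits
  c<lo = ListAll.++⁻ˡ lo (All-resp-↭ w↭ c<w)
  u<H = ListAll.++⁺ (VecAll.toList⁺ u<us) u<hi
  tightCut : ∀ {t} → TightAt n (suc (d + c) ∷ toList us ++ w) t → suc (d + c) ≤ t → TightAt n H t
  tightCut {t} tt u≤t = trans (cong (_+ t) (sym (above-cut-≥ H lo≤u u≤t))) (tight-↭ perm tt)
  full : length H + suc (d + c) ≡ n
  full = trans (cong (_+ suc (d + c)) (sym (above-< u<H))) (tightCut tight₁ ≤-refl)

-- Going from `u` down to `c` adds the entry `u` and those of `α`, against `u ∸ c` spots. This is
-- separate from joining and splitting because the first block need not be full.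
length-gap : ∀ {n c u k} {us : Vec ℕ k} {w w′} α → c < u → w ↭ map (_+ c) α ++ w′ →
             length (toList us ++ w′) + u ≡ n →
             (length α ≡ u ∸ c ∸ 1 → length (u ∷ toList us ++ w) + c ≡ n) ×
             (length (u ∷ toList us ++ w) + c ≡ n → length α ≡ u ∸ c ∸ 1)
length-gap {n} {c} {us = us} {w} {w′} α c<u w↭ full with <⇒gap c<u
... | d , refl , eq rewrite eq =
  (λ { refl → trans total (trans (rearrange (length α) L c) full) }) ,
  (λ total′ → +-cancelʳ-≡ (suc (L + c)) (length α) d
    (trans (rearrange′ (length α) L c)
      (trans (sym total) (trans total′ (trans (sym full) (rearrange″ L d c))))))
  where
  L = length (toList us ++ w′)
  total : length (suc (d + c) ∷ toList us ++ w) + c ≡ length α + suc L + c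
  total = cong (_+ c) (trans (↭-length (cut-↭ (suc (d + c)) (toList us) (map (_+ c) α) w↭))
    (trans (length-++ (map (_+ c) α)) (cong (_+ suc L) (length-map (_+ c) α))))
  rearrange : ∀ a b c → a + suc b + c ≡ b + suc (a + c)
  rearrange = solve-∀
  rearrange′ : ∀ a b c → a + suc (b + c) ≡ a + suc b + c
  rearrange′ = solve-∀
  rearrange″ : ∀ a b c → a + suc (b + c) ≡ b + suc (a + c)
  rearrange″ = solve-∀

-- From multi-shuffles to tight words and back

blocks⇒gaps : ∀ {n c k} {us : Vec ℕ k} {w} → c ≤ n → Linked _<_ (c ∷ us) → All (_≤ n) us →
              Blocks n c us w → Gaps n c us w
blocks⇒gaps {n} {c} c≤n _ _ (last {α} pf) = record
  { larger = map-+-> c pf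
  ; fits = subst (λ t → FitsFrom t c (map (_+ c) α)) (m∸n+n≡m c≤n) (fits-map-+⁺ c α (PF⇒fits pf))
  ; tight = []
  ; full = trans (cong (_+ c) (trans (length-map (_+ c) α) (PF.length≡m pf))) (m∸n+n≡m c≤n)
  }
blocks⇒gaps {n} {c} c≤n (c<u ∷ l) (u≤n ∷ us≤n) (next {us = us} {α} pf bs) = record
  { larger = ListAll.++⁺ (map-+-> c pf) (ListAll.map (<-trans c<u) larger)
  ; fits = proj₁ joined
  ; tight = proj₂ joined
  ; full = proj₁ (length-gap {us = us} α c<u ↭-refl full) (PF.length≡m pf)
  }
  where
  gaps = blocks⇒gaps u≤n l us≤n bs
  open Gaps gaps
  joined = gaps-join c<u (linked⇒all l) pf gaps

-- `Blocks` fixes the order of the blocks, so `w` is recovered only up to rearrangement. Fullness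
-- from both ends of a gap gives its block as many cars as spots.
gaps⇒blocks : ∀ {n c k} {us : Vec ℕ k} {w} → Linked _<_ (c ∷ us) →
              Gaps n c us w → ∃ λ w′ → Blocks n c us w′ × w ↭ w′
gaps⇒blocks {n} {c} {us = []} {w} _ gaps =
  _ , last (subst (λ t → PF t (n ∸ c) (map (_∸ c) w)) length≡
        (fits⇒PF (map-∸-positive larger) (fits-map-+⁻ c (map (_∸ c) w) fits′))) ,
  ↭-reflexive (sym (map-∸-+ larger))
  where
  open Gaps gaps
  length≡ : length (map (_∸ c) w) ≡ n ∸ c
  length≡ = trans (length-map (_∸ c) w) (trans (sym (m+n∸n≡m (length w) c)) (cong (_∸ c) full))
  fits′ : FitsFrom (n ∸ c + c) c (map (_+ c) (map (_∸ c) w))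
  fits′ = subst₂ (λ t → FitsFrom t c)
    (sym (m∸n+n≡m (subst (c ≤_) full (m≤n+m c (length w))))) (sym (map-∸-+ larger)) fits
gaps⇒blocks {n} {c} {us = u ∷ us} (c<u ∷ l) gaps
  with gaps-split c<u (linked⇒all l) (Gaps.larger gaps) (Gaps.fits gaps) (Gaps.tight gaps)
... | α , w₁ , w↭ , pf , gaps₁ with gaps⇒blocks l gaps₁
... | w₂ , bs , w₁↭w₂ =
  _ , next (subst (λ t → PF t (u ∸ c ∸ 1) α)
        (proj₂ (length-gap {us = us} α c<u w↭ (Gaps.full gaps₁)) (Gaps.full gaps)) pf) bs ,
  ↭-trans w↭ (++⁺ˡ (map (_+ c) α) w₁↭w₂)

-- Position `0` acts as a cut before the street, so that the first block is the gap after `c = 0`.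
positive-linked : ∀ {n k} {us : Vec ℕ k} → Increasing n us → Linked _<_ (0 ∷ us)
positive-linked {us = []}    _                     = [-]
positive-linked {us = _ ∷ _} (((1≤u , _) ∷ _) , l) = 1≤u ∷ l

MS⇒tight : ∀ {m n k} {u : Vec ℕ k} {π} → Increasing n u → MS m n u π →
           FitsFrom n 0 (toList u ++ π) × All (TightAt n (toList u ++ π)) u
MS⇒tight {n = n} inc@((1≤u , u≤n) ∷ r , l) (shuffle {u₁ = u₁} {us} {α₁} {w} pf bs π↭)
  with gaps-join {c = 0} 1≤u (linked⇒all l) pf (blocks⇒gaps u≤n l (VecAll.map proj₂ r) bs)
... | fits , tight = fits-↭ perm fits , VecAll.map (tight-↭ perm) tight
  where
  perm = prep u₁ (++⁺ˡ (toList us) (↭-trans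
    (↭-reflexive (cong (_++ w) (trans (map-cong +-identityʳ α₁) (map-id α₁)))) (↭-sym π↭)))

tight⇒MS : ∀ {m n k} {u : Vec ℕ (suc k)} {π} → Increasing n u → ListAll.All (1 ≤_) π →
           suc k + length π ≡ m → FitsFrom n 0 (toList u ++ π) → All (TightAt n (toList u ++ π)) u →
           MS m n u π
tight⇒MS {m} {n} {k} {u = u₁ ∷ us} {π} ((1≤u , u≤n) ∷ r , l) 1≤π refl fits tight
  with gaps-split {c = 0} 1≤u (linked⇒all l) 1≤π fits tight
... | α , w₁ , π↭ , pf , gaps₁ with gaps⇒blocks l gaps₁
... | w₂ , bs , w₁↭w₂ = shuffle (subst (λ t → PF t (u₁ ∸ 1) α) length≡ pf) bs
  (↭-trans π↭ (↭-trans (↭-reflexive (cong (_++ w₁) (trans (map-cong +-identityʳ α) (map-id α))))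
    (++⁺ˡ α w₁↭w₂)))
  where
  open ≡-Reasoning
  rearrange : ∀ a b c d → suc (d + (a + b)) + c ≡ suc a + (d + b + c)
  rearrange = solve-∀
  -- Fullness puts `n ∸ u₁` entries beyond `u₁`; the others among all `suc k + length π` entries are
  -- `u₁` and those of `α`.
  length≡ : length α ≡ suc k + length π + u₁ ∸ n ∸ 1
  length≡ = sym (begin
    suc k + length π + u₁ ∸ n ∸ 1
      ≡⟨ cong (λ t → suc k + t + u₁ ∸ n ∸ 1)
           (trans (↭-length π↭) (trans (length-++ (map (_+ 0) α)) (cong (_+ length w₁) (length-map _ α)))) ⟩
    suc k + (length α + length w₁) + u₁ ∸ n ∸ 1
      ≡⟨ cong (λ t → t ∸ n ∸ 1) (rearrange (length α) (length w₁) u₁ k) ⟩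
    suc (length α) + (k + length w₁ + u₁) ∸ n ∸ 1
      ≡⟨ cong (λ t → suc (length α) + (t + u₁) ∸ n ∸ 1)
           (trans (cong (_+ length w₁) (sym (length-toList us))) (sym (length-++ (toList us)))) ⟩
    suc (length α) + (length (toList us ++ w₁) + u₁) ∸ n ∸ 1
      ≡⟨ cong (λ t → suc (length α) + t ∸ n ∸ 1) (Gaps.full gaps₁) ⟩
    suc (length α) + n ∸ n ∸ 1
      ≡⟨ cong (_∸ 1) (m+n∸n≡m (suc (length α)) n) ⟩
    length α ∎)

-- The maximal element of A

-- At each tight `t` the count for `us` is the largest possible and `X` cancels, so `vs` has no more
-- entries above `t`. These counts at the entries of `us` alone force the pointwise bound.
tight⇒≤ : ∀ {n c k} {us vs : Vec ℕ k} {X} → Linked _<_ (c ∷ us) → Linked _<_ vs → All (_≤ n) us →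
          All (TightAt n (toList us ++ X)) us → FitsFrom n 0 (toList vs ++ X) → Pointwise _≤_ vs us
tight⇒≤ {n} {us = us} {vs} {X} lu lv us≤n tight fits =
  go lu lv (VecAll.map (λ {t} (tt , t≤n) → bound t tt t≤n) (VecAll.zip (tight , us≤n)))
  where
  bound : ∀ t → TightAt n (toList us ++ X) t → t ≤ n → above t (toList vs) ≤ above t (toList us)
  bound t tt t≤n = +-cancelʳ-≤ (above t X) _ _ (subst₂ _≤_ (above-++ t (toList vs) X) (above-++ t (toList us) X)
    (+-cancelʳ-≤ t _ _ (≤-trans (fits t z≤n t≤n) (≤-reflexive (sym tt)))))
  go : ∀ {c k} {us vs : Vec ℕ k} → Linked _<_ (c ∷ us) → Linked _<_ vs →
       All (λ t → above t (toList vs) ≤ above t (toList us)) us → Pointwise _≤_ vs us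
  go {us = []} {[]} _ _ _ = []
  go {us = u ∷ us} {v ∷ vs} (_ ∷ lu) lv (p ∷ ps) =
    v≤u ∷ go lu (Linked.tail lv) (VecAll.map drop (VecAll.zip (ps , u<us)))
    where
    open ≤-Reasoning
    u<us = linked⇒all lu
    v≤u : v ≤ u
    -- If `u < v`, every entry of `v ∷ vs` exceeds `u`, one more than in `u ∷ us`.
    v≤u = ≮⇒≥ λ u<v → <⇒≱ (n<1+n _) (begin
      suc _                            ≡⟨ cong suc (length-toList vs) ⟨
      length (toList (v ∷ vs))         ≡⟨ above-< (VecAll.toList⁺ (u<v ∷ VecAll.map (<-trans u<v) (linked⇒all lv))) ⟨
      above u (toList (v ∷ vs))        ≤⟨ p ⟩
      gt u u + above u (toList us)     ≡⟨ cong (_+ above u (toList us)) (gt-≥ (≤-refl {u})) ⟩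
      above u (toList us)              ≡⟨ above-< (VecAll.toList⁺ u<us) ⟩
      length (toList us)               ≡⟨ length-toList us ⟩
      _                                ∎)
    drop : ∀ {t} → above t (toList (v ∷ vs)) ≤ above t (toList (u ∷ us)) × u < t →
           above t (toList vs) ≤ above t (toList us)
    drop {t} (q , u<t) = subst₂ _≤_
      (cong (_+ above t (toList vs)) (gt-≥ (≤-trans v≤u (<⇒≤ u<t))))
      (cong (_+ above t (toList us)) (gt-≥ (<⇒≤ u<t))) q

-- Only the count at threshold `u` changes, by one, and the slack there absorbs it.
fits-bump : ∀ {n u xs} → FitsFrom n 0 (u ∷ xs) → above u (u ∷ xs) + u < n → FitsFrom n 0 (suc u ∷ xs)
fits-bump {n} {u} {xs} fits slack k _ k≤n with k ≟ u
... | yes refl rewrite gt-< (n<1+n u) | gt-≥ (≤-refl {u}) = slack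
... | no k≢u rewrite gt-≢-suc k≢u = fits k z≤n k≤n

-- Only vectors with entries above `c` compete. Thus a head moved into `X` can be put back in front
-- of every competitor of the tail.
Maximal : ∀ {k} → ℕ → ℕ → List ℕ → Vec ℕ k → Set
Maximal {k} n c X us = (vs : Vec ℕ k) → Linked _<_ (c ∷ vs) → All (_≤ n) vs →
                       FitsFrom n 0 (toList vs ++ X) → Pointwise _≤_ vs us

maximal⇒tight-head : ∀ {n c u k} (us : Vec ℕ k) {X} → c < u → Linked _<_ (u ∷ us) →
                     u ≤ n → All (_≤ n) us → FitsFrom n 0 (u ∷ toList us ++ X) →
                     Maximal n c X (u ∷ us) → All (TightAt n (u ∷ toList us ++ X)) us →
                     TightAt n (u ∷ toList us ++ X) u
maximal⇒tight-head {u = u} us c<u l u≤n us≤n fits max tight with m≤n⇒m<n∨m≡n (fits u z≤n u≤n)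
... | inj₂ eq = eq
maximal⇒tight-head {u = u} [] {X} c<u l u≤n us≤n fits max tight | inj₁ slack =
  contradiction
    -- The slack also gives `u < n`, so `suc u` is still a spot.
    (Pointwise.head (max (suc u ∷ []) (m≤n⇒m≤1+n c<u ∷ [-]) (≤-<-trans (m≤n+m u _) slack ∷ [])
      (fits-bump {u = u} {X} fits slack)))
    (<⇒≱ (n<1+n u))
maximal⇒tight-head {n} {u = u} (u′ ∷ us) {X} c<u (u<u′ ∷ l) u≤n (u′≤n ∷ us≤n) fits max (t′ ∷ _)
  | inj₁ slack with m≤n⇒m<n∨m≡n u<u′
... | inj₁ u+1<u′ =
  contradiction
    (Pointwise.head (max (suc u ∷ u′ ∷ us) (m≤n⇒m≤1+n c<u ∷ u+1<u′ ∷ l)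
      (≤-trans u<u′ u′≤n ∷ u′≤n ∷ us≤n)
      (fits-bump {u = u} {u′ ∷ toList us ++ X} fits slack)))
    (<⇒≱ (n<1+n u))
-- Here `suc u` is an entry of `U`, so lowering the threshold to `u` gains an entry and makes up for
-- the smaller threshold.
... | inj₂ refl = ≤-antisym (fits u z≤n u≤n) (begin
  n                           ≡⟨ t′ ⟨
  above (suc u) U + suc u     ≡⟨ +-suc _ u ⟩
  suc (above (suc u) U) + u   ≤⟨ +-monoˡ-≤ u (above-suc-∈ {u} {U} (there (here refl))) ⟩
  above u U + u               ∎)
  where
  open ≤-Reasoning
  U = u ∷ suc u ∷ toList us ++ X

-- The tail comes first, with the head moved into `X`, because tightness at the head may rest on
-- tightness at the next entry.
maximal⇒tight : ∀ {n c k} {us : Vec ℕ k} {X} → Linked _<_ (c ∷ us) → All (_≤ n) us →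
                FitsFrom n 0 (toList us ++ X) → Maximal n c X us →
                All (TightAt n (toList us ++ X)) us
maximal⇒tight {us = []} _ _ _ _ = []
maximal⇒tight {n} {us = u ∷ us} {X} (c<u ∷ l) (u≤n ∷ us≤n) fits max =
  maximal⇒tight-head us c<u l u≤n us≤n fits max tight ∷ tight
  where
  move : ∀ {k} (vs : Vec ℕ k) → toList vs ++ u ∷ X ↭ u ∷ toList vs ++ X
  move vs = shift u (toList vs) X
  tight : All (TightAt n (u ∷ toList us ++ X)) us
  tight = VecAll.map (tight-↭ (move us))
    (maximal⇒tight l us≤n (fits-↭ (↭-sym (move us)) fits)
      λ vs lv vs≤n fitsV → Pointwise.tail
        (max (u ∷ vs) (c<u ∷ lv) (u≤n ∷ vs≤n) (fits-↭ (move vs) fitsV)))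

-- Equality with `[u]` through tightness

theorem2p4 : (l m n : ℕ) → 1 ≤ l → l ≤ m → m ≤ n →
    (u : Vec ℕ l) → Increasing n u →
    (∀ i → n ∸ m + suc (toℕ i) ≤ lookup u i) →
    (π : Vec ℕ (m ∸ l)) → All (InRange n) π →
    (A m n (toList π) ≐ Below n u) ⇔ MS m n u (toList π)
theorem2p4 (suc l) m n _ l≤m _ u incU@(rangeU , linkU) _ π rangeπ = mk⇔ to from
  where
  length≡m : (v : Vec ℕ (suc l)) → length (toList v ++ toList π) ≡ m
  length≡m v = trans (length-++ (toList v))
    (trans (cong₂ _+_ (length-toList v) (length-toList π)) (m+[n∸m]≡n l≤m))

  fits⇒A : ∀ v → Increasing n v → FitsFrom n 0 (toList v ++ toList π) → A m n (toList π) v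
  fits⇒A v inc fits = inc , subst (λ t → PF t n (toList v ++ toList π)) (length≡m v)
    (fits⇒PF (ListAll.map proj₁ (ListAll.++⁺ (VecAll.toList⁺ (proj₁ inc)) (VecAll.toList⁺ rangeπ))) fits)

  linkU₀ : Linked _<_ (0 ∷ u)
  linkU₀ = positive-linked incU

  to : A m n (toList π) ≐ Below n u → MS m n u (toList π)
  to (A⊆Below , Below⊆A) =
    tight⇒MS incU (ListAll.map proj₁ (VecAll.toList⁺ rangeπ))
      (trans (cong (suc l +_) (length-toList π)) (m+[n∸m]≡n l≤m)) fits
      (maximal⇒tight linkU₀ (VecAll.map proj₂ rangeU) fits
        λ v linkV v≤n fitsV → proj₂ (A⊆Below (fits⇒A v
          (VecAll.zip (linked⇒all linkV , v≤n) , Linked.tail linkV) fitsV)))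
    where
    fits : FitsFrom n 0 (toList u ++ toList π)
    -- `u` itself belongs to `[u]`.
    fits = PF⇒fits (proj₂ (Below⊆A (incU , Pointwise.refl ≤-refl)))

  from : MS m n u (toList π) → A m n (toList π) ≐ Below n u
  from ms with MS⇒tight incU ms
  ... | fits , tight =
    (λ (incV , pf) → incV ,
      tight⇒≤ linkU₀ (proj₂ incV) (VecAll.map proj₂ rangeU) tight (PF⇒fits pf)) ,
    (λ {v} (incV , v≤u) → fits⇒A v incV (fits-≤ {xs = toList v ++ toList π} {toList u ++ toList π}
      (λ k → subst₂ _≤_ (sym (above-++ k (toList v) (toList π))) (sym (above-++ k (toList u) (toList π)))
        (+-monoˡ-≤ (above k (toList π)) (above-mono k v≤u))) fits))
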